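{- Let $M$ be a matroid with rank function $\operatorname{rk}$, and let $X$ and $Y$ be flats of $M$ with $\delta(X,Y)>0$. If $M$ has an extension $M'$ such that $\delta_{M'}\big(\operatorname{cl}_{M'}(X),\operatorname{cl}_{M'}(Y)\big)<\delta(X,Y)$, then $M$ is not sticky.
   Context: For subsets $X,Y$ of the ground set of a matroid with rank function $\operatorname{rk}$, the modular defect is $\delta(X,Y)=\operatorname{rk}(X)+\operatorname{rk}(Y)-\operatorname{rk}(X\cup Y)-\operatorname{rk}(X\cap Y)$ ($\delta_{M'}$ denotes the same quantity computed in $M'$); $(X,Y)$ is a modular pair if $\delta(X,Y)=0$. An extension of a matroid $M$ on $E$ is a matroid $N$ on a set $F\supseteq E$ with $N|E=M$. If $N_1,N_2$ are extensions of $M$ on ground sets $F_1,F_2$ with $F_1\cap F_2=E$, an amalgam of $N_1$ and $N_2$ is a matroid on $F_1\cup F_2$ whose restriction to $F_i$ is $N_i$ for $i=1,2$. A matroid $M$ is sticky if for every such pair of extensions $N_1,N_2$ an amalgam exists. -}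

module Defs where

open import Data.Nat using (ℕ; _+_; _∸_; _≤_; _≟_)
open import Data.Fin using (Fin)
open import Data.Fin.Subset using (Subset; _∪_; _∩_; _⊆_; ⊥; ⁅_⁆; ∣_∣; inside; outside)
open import Data.Vec using (_++_; tabulate)
open import Data.Product using (Σ; _×_)
open import Relation.Binary.PropositionalEquality using (_≡_)
open import Relation.Nullary using (does)
open import Data.Bool using (if_then_else_)

record Matroid (n : ℕ) : Set where
  field
    rk          : Subset n → ℕ
    rk-card     : ∀ X → rk X ≤ ∣ X ∣
    rk-mono     : ∀ {X Y} → X ⊆ Y → rk X ≤ rk Y
    rk-submod   : ∀ X Y → rk (X ∪ Y) + rk (X ∩ Y) ≤ rk X + rk Y
open Matroid public

-- modular defect δ(X,Y) = rk X + rk Y - rk (X ∪ Y) - rk (X ∩ Y)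
-- (non-negative by submodularity, so truncated subtraction is exact)
δ : ∀ {n} → Matroid n → Subset n → Subset n → ℕ
δ M X Y = (rk M X + rk M Y) ∸ (rk M (X ∪ Y) + rk M (X ∩ Y))

cl : ∀ {n} → Matroid n → Subset n → Subset n
cl M X = tabulate λ e →
  if does (rk M (X ∪ ⁅ e ⁆) ≟ rk M X) then inside else outside

IsFlat : ∀ {n} → Matroid n → Subset n → Set
IsFlat M X = cl M X ≡ X

-- A subset of the ground set Fin n of M, viewed as a subset of the ground
-- set Fin (n + k) of an extension (the first n elements form E).
embed : ∀ {n} k → Subset n → Subset (n + k)
embed k X = X ++ ⊥

IsExtension : ∀ {n k} → Matroid n → Matroid (n + k) → Set
IsExtension {n} {k} M N = ∀ X → rk N (embed k X) ≡ rk M X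

-- Amalgam of N₁ on E ⊔ F₁' = Fin (n + k₁) and N₂ on E ⊔ F₂' = Fin (n + k₂):
-- a matroid on Fin (n + (k₁ + k₂)) (= E ⊔ F₁' ⊔ F₂') whose restrictions
-- to E ⊔ F₁' and E ⊔ F₂' are N₁ and N₂.
IsAmalgam : ∀ {n k₁ k₂} → Matroid (n + k₁) → Matroid (n + k₂)
          → Matroid (n + (k₁ + k₂)) → Set
IsAmalgam {n} {k₁} {k₂} N₁ N₂ A =
  (∀ (X : Subset n) (P : Subset k₁) → rk A (X ++ (P ++ ⊥)) ≡ rk N₁ (X ++ P)) ×
  (∀ (X : Subset n) (Q : Subset k₂) → rk A (X ++ (⊥ {k₁} ++ Q)) ≡ rk N₂ (X ++ Q))

Sticky : ∀ {n} → Matroid n → Set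
Sticky {n} M = ∀ k₁ k₂ (N₁ : Matroid (n + k₁)) (N₂ : Matroid (n + k₂))
  → IsExtension M N₁ → IsExtension M N₂
  → Σ (Matroid (n + (k₁ + k₂))) (IsAmalgam {n} {k₁} {k₂} N₁ N₂)

{-# OPTIONS --safe #-}
module Submission where

-- Let T = X ∩ Y have rank t. If the extension M′ lowers the defect, contracting cl X ∩ cl Y gives a
-- quotient of M in which X and Y lose the same rank k > 0 while T keeps its rank. From any such
-- quotient q we build one with k + 1 when M is sticky; as k ≤ rk X, this cannot go on.
--
-- Extend M by a point e generic for q, so that e lies in the closures of X and Y but not of T.
-- Extend M also by k + 1 large blocks such that any k blocks C satisfy rk (Z ∪ C) = q Z + |C| for
-- Z ⊇ T, while over T the blocks are independent (for k = 1 this is the Vámos configuration).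
-- In an amalgam, if e is outside the closure of T ∪ C for one choice of C, then contracting C ∪ e
-- gives the next quotient. Otherwise e lies in the closure of every T ∪ C, and by modularity over T
-- in the closure of their intersection T, a contradiction.

open import Defs
open import Data.Nat using (ℕ; _+_; _<_)
open import Data.Fin.Subset using (Subset)
open import Relation.Nullary using (¬_)

open import Data.Bool using (if_then_else_)
open import Data.Empty using (⊥-elim)
open import Data.Fin using (Fin; zero; suc)
open import Data.Fin.Properties using (any?)
open import Data.Fin.Subset
  using (_∪_; _∩_; _⊆_; _∈_; ⊥; ⊤; ⁅_⁆; ∣_∣; ⋃; inside; outside)
open import Data.Fin.Subset.Properties
open import Data.List using ([]; _∷_; map; filter; allFin)
open import Data.List.Membership.Propositional using () renaming (_∈_ to _∈ˡ_)
open import Data.List.Membership.Propositional.Properties using (∈-allFin; ∈-filter⁺)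
open import Data.List.Relation.Unary.All using (All; []; _∷_)
open import Data.List.Relation.Unary.All.Properties using (all-filter)
open import Data.List.Relation.Unary.Any using (here; there)
open import Data.Nat using (zero; suc; _*_; _∸_; _⊓_; _≤_; z≤n; s≤s; s≤s⁻¹; _≟_; _<?_; _≤?_)
open import Data.Nat.Properties
open import Data.Nat.Tactic.RingSolver using (solve-∀)
open import Data.Product using (_×_; _,_; proj₁; proj₂; ∃)
open import Data.Sum using (_⊎_; inj₁; inj₂; [_,_]′)
open import Data.Vec using ([]; _∷_; _++_; take; drop; here; there)
open import Data.Vec.Properties
  using (take-zipWith; drop-zipWith; take++drop≡id; zipWith-++; ++-injective;
         lookup∘tabulate; []=⇒lookup; lookup⇒[]=)
open import Function using (_∘_)
open import Relation.Binary.PropositionalEquality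
open import Relation.Nullary using (yes; no)
open import Relation.Nullary.Decidable using (dec-true; dec-false)

private variable
  m n : ℕ

-- Subsets: inclusion, cardinality and concatenation

∪-least : {p q r : Subset n} → p ⊆ r → q ⊆ r → p ∪ q ⊆ r
∪-least {p = p} {q} p⊆r q⊆r = [ p⊆r , q⊆r ]′ ∘ x∈p∪q⁻ p q

∩-greatest : {p q r : Subset n} → r ⊆ p → r ⊆ q → r ⊆ p ∩ q
∩-greatest r⊆p r⊆q x∈r = x∈p∩q⁺ (r⊆p x∈r , r⊆q x∈r)

∪-mono-⊆ : {p p′ q q′ : Subset n} → p ⊆ p′ → q ⊆ q′ → p ∪ q ⊆ p′ ∪ q′
∪-mono-⊆ {p′ = p′} {q′ = q′} p⊆p′ q⊆q′ =
  ∪-least (p⊆p∪q q′ ∘ p⊆p′) (q⊆p∪q p′ q′ ∘ q⊆q′)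

∣p∪q∣+∣p∩q∣ : (p q : Subset n) → ∣ p ∪ q ∣ + ∣ p ∩ q ∣ ≡ ∣ p ∣ + ∣ q ∣
∣p∪q∣+∣p∩q∣ [] [] = refl
∣p∪q∣+∣p∩q∣ (inside ∷ p) (inside ∷ q) =
  cong suc (trans (+-suc _ _) (trans (cong suc (∣p∪q∣+∣p∩q∣ p q)) (sym (+-suc _ _))))
∣p∪q∣+∣p∩q∣ (inside ∷ p) (outside ∷ q) = cong suc (∣p∪q∣+∣p∩q∣ p q)
∣p∪q∣+∣p∩q∣ (outside ∷ p) (inside ∷ q) =
  trans (cong suc (∣p∪q∣+∣p∩q∣ p q)) (sym (+-suc _ _))
∣p∪q∣+∣p∩q∣ (outside ∷ p) (outside ∷ q) = ∣p∪q∣+∣p∩q∣ p q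

∣p++q∣ : (p : Subset n) (q : Subset m) → ∣ p ++ q ∣ ≡ ∣ p ∣ + ∣ q ∣
∣p++q∣ [] q = refl
∣p++q∣ (inside ∷ p) q = cong suc (∣p++q∣ p q)
∣p++q∣ (outside ∷ p) q = ∣p++q∣ p q

++-mono-⊆ : (p p′ : Subset n) {q q′ : Subset m} → p ⊆ p′ → q ⊆ q′ → p ++ q ⊆ p′ ++ q′
++-mono-⊆ [] [] _ q⊆q′ = q⊆q′
++-mono-⊆ (x ∷ p) (y ∷ p′) p⊆p′ q⊆q′ here with p⊆p′ here
... | here = here
++-mono-⊆ (x ∷ p) (y ∷ p′) p⊆p′ q⊆q′ (there i) =
  there (++-mono-⊆ p p′ (drop-∷-⊆ p⊆p′) q⊆q′ i)

++-⊆⁻ : (p p′ : Subset n) {q q′ : Subset m} → p ++ q ⊆ p′ ++ q′ → p ⊆ p′ × q ⊆ q′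
++-⊆⁻ [] [] h = (λ ()) , h
++-⊆⁻ (x ∷ p) (y ∷ p′) h = left , proj₂ (++-⊆⁻ p p′ (drop-∷-⊆ h))
  where
  left : x ∷ p ⊆ y ∷ p′
  left here with h here
  ... | here = here
  left (there i) = there (proj₁ (++-⊆⁻ p p′ (drop-∷-⊆ h)) i)

module _ (n : ℕ) {m : ℕ} where

  take-drop-⊆ : {p q : Subset (n + m)} → p ⊆ q → take n p ⊆ take n q × drop n p ⊆ drop n q
  take-drop-⊆ {p} {q} p⊆q = ++-⊆⁻ (take n p) (take n q)
    (subst₂ _⊆_ (sym (take++drop≡id n p)) (sym (take++drop≡id n q)) p⊆q)

  ∣take∣+∣drop∣ : (p : Subset (n + m)) → ∣ take n p ∣ + ∣ drop n p ∣ ≡ ∣ p ∣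
  ∣take∣+∣drop∣ p =
    trans (sym (∣p++q∣ (take n p) (drop n p))) (cong ∣_∣ (take++drop≡id n p))

  take-drop-++ : (p : Subset n) (q : Subset m) → take n (p ++ q) ≡ p × drop n (p ++ q) ≡ q
  take-drop-++ p q = ++-injective (take n (p ++ q)) p (take++drop≡id n (p ++ q))

  take-∪ : (p q : Subset (n + m)) → take n (p ∪ q) ≡ take n p ∪ take n q
  take-∪ = take-zipWith _

  drop-∪ : (p q : Subset (n + m)) → drop n (p ∪ q) ≡ drop n p ∪ drop n q
  drop-∪ = drop-zipWith {m = n} _

  take-∩ : (p q : Subset (n + m)) → take n (p ∩ q) ≡ take n p ∩ take n q
  take-∩ = take-zipWith _

  drop-∩ : (p q : Subset (n + m)) → drop n (p ∩ q) ≡ drop n p ∩ drop n q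
  drop-∩ = drop-zipWith {m = n} _

⊥++⊥ : ∀ n → ⊥ {n} ++ ⊥ {m} ≡ ⊥ {n + m}
⊥++⊥ zero = refl
⊥++⊥ (suc n) = cong (outside ∷_) (⊥++⊥ n)

⊤++⊤ : ∀ n → ⊤ {n} ++ ⊤ {m} ≡ ⊤ {n + m}
⊤++⊤ zero = refl
⊤++⊤ (suc n) = cong (inside ∷_) (⊤++⊤ n)

+-interchange : ∀ a b c d → (a + b) + (c + d) ≡ (a + c) + (b + d)
+-interchange = solve-∀

-- Counting the blocks that a set does not fill

-- Indicator of a proper subset of the block, so that `∣ p ∣ + defect p ∸ 1` is the rank of `p` in a
-- circuit. Not to be confused with the modular defect `δ`.
defect : Subset n → ℕ
defect [] = 0
defect (inside ∷ p) = defect p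
defect (outside ∷ p) = 1

defect≤1 : (p : Subset n) → defect p ≤ 1
defect≤1 [] = z≤n
defect≤1 (inside ∷ p) = defect≤1 p
defect≤1 (outside ∷ p) = ≤-refl

defect-antitone : (p q : Subset n) → p ⊆ q → defect q ≤ defect p
defect-antitone [] [] _ = z≤n
defect-antitone (inside ∷ p) (inside ∷ q) h = defect-antitone p q (drop-∷-⊆ h)
defect-antitone (inside ∷ p) (outside ∷ q) h with h here
... | ()
defect-antitone (outside ∷ p) q h = defect≤1 q

-- If the union misses an element, so do both sets; if the intersection misses one, so does at least
-- one of them.
defect-submod : (p q : Subset n) → defect (p ∪ q) + defect (p ∩ q) ≤ defect p + defect q
defect-submod [] [] = z≤n
defect-submod (inside ∷ p) (inside ∷ q) = defect-submod p q
defect-submod (inside ∷ p) (outside ∷ q) =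
  +-monoˡ-≤ 1 (defect-antitone p (p ∪ q) (p⊆p∪q q))
defect-submod (outside ∷ p) (inside ∷ q) =
  ≤-trans (+-monoˡ-≤ 1 (defect-antitone q (p ∪ q) (q⊆p∪q p q))) (≤-reflexive (+-comm _ 1))
defect-submod (outside ∷ p) (outside ∷ q) = ≤-refl

-- Where `defect` drops from 1 to 0, at least one new element pays for it.
∣p∣+defect-mono : (p q : Subset n) → p ⊆ q → ∣ p ∣ + defect p ≤ ∣ q ∣ + defect q
∣p∣+defect-mono [] [] _ = z≤n
∣p∣+defect-mono (inside ∷ p) (inside ∷ q) h = s≤s (∣p∣+defect-mono p q (drop-∷-⊆ h))
∣p∣+defect-mono (inside ∷ p) (outside ∷ q) h with h here
... | ()
∣p∣+defect-mono (outside ∷ p) (inside ∷ q) h =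
  ≤-trans (+-monoˡ-≤ 1 (p⊆q⇒∣p∣≤∣q∣ (drop-∷-⊆ h)))
    (≤-trans (≤-reflexive (+-comm _ 1)) (s≤s (m≤m+n _ _)))
∣p∣+defect-mono (outside ∷ p) (outside ∷ q) h = +-monoˡ-≤ 1 (p⊆q⇒∣p∣≤∣q∣ (drop-∷-⊆ h))

defect-⊤ : ∀ n → defect (⊤ {n}) ≡ 0
defect-⊤ zero = refl
defect-⊤ (suc n) = defect-⊤ n

defect≡0⇒∣p∣≡n : (p : Subset n) → defect p ≡ 0 → ∣ p ∣ ≡ n
defect≡0⇒∣p∣≡n [] _ = refl
defect≡0⇒∣p∣≡n (inside ∷ p) eq = cong suc (defect≡0⇒∣p∣≡n p eq)

-- Block size is `suc b` so that blocks are nonempty: the empty set then leaves every block nonfull.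
module Blocks (b : ℕ) where

  nonfull : ∀ j → Subset (j * suc b) → ℕ
  nonfull zero _ = 0
  nonfull (suc j) S = defect (take (suc b) S) + nonfull j (drop (suc b) S)

  nonfull-++ : ∀ j (B : Subset (suc b)) S → nonfull (suc j) (B ++ S) ≡ defect B + nonfull j S
  nonfull-++ j B S = cong₂ (λ p q → defect p + nonfull j q)
    (proj₁ (take-drop-++ (suc b) B S)) (proj₂ (take-drop-++ (suc b) B S))

  nonfull-antitone : ∀ j {S S′} → S ⊆ S′ → nonfull j S′ ≤ nonfull j S
  nonfull-antitone zero _ = z≤n
  nonfull-antitone (suc j) {S} {S′} S⊆S′ with take-drop-⊆ (suc b) {p = S} {S′} S⊆S′
  ... | t⊆ , d⊆ = +-mono-≤ (defect-antitone _ _ t⊆) (nonfull-antitone j d⊆)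

  nonfull-submod : ∀ j S S′ → nonfull j (S ∪ S′) + nonfull j (S ∩ S′) ≤ nonfull j S + nonfull j S′
  nonfull-submod zero S S′ = z≤n
  nonfull-submod (suc j) S S′
    rewrite take-∪ (suc b) S S′ | drop-∪ (suc b) S S′ | take-∩ (suc b) S S′ | drop-∩ (suc b) S S′ =
    subst₂ _≤_
      (+-interchange (defect (B ∪ B′)) _ (nonfull j (R ∪ R′)) _)
      (+-interchange (defect B) _ (nonfull j R) _)
      (+-mono-≤ (defect-submod B B′) (nonfull-submod j R R′))
    where
    B = take (suc b) S
    B′ = take (suc b) S′
    R = drop (suc b) S
    R′ = drop (suc b) S′

  ∣S∣+nonfull-mono : ∀ j {S S′} → S ⊆ S′ → ∣ S ∣ + nonfull j S ≤ ∣ S′ ∣ + nonfull j S′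
  ∣S∣+nonfull-mono zero {[]} {[]} _ = z≤n
  ∣S∣+nonfull-mono (suc j) {S} {S′} S⊆S′ with take-drop-⊆ (suc b) {p = S} {S′} S⊆S′
  ... | t⊆ , d⊆ = begin
    ∣ S ∣ + (defect B + nonfull j R)              ≡⟨ cong (_+ (defect B + nonfull j R)) (∣take∣+∣drop∣ (suc b) S) ⟨
    (∣ B ∣ + ∣ R ∣) + (defect B + nonfull j R)    ≡⟨ +-interchange (∣ B ∣) _ _ _ ⟩
    (∣ B ∣ + defect B) + (∣ R ∣ + nonfull j R)
      ≤⟨ +-mono-≤ (∣p∣+defect-mono _ _ t⊆) (∣S∣+nonfull-mono j d⊆) ⟩
    (∣ B′ ∣ + defect B′) + (∣ R′ ∣ + nonfull j R′) ≡⟨ +-interchange (∣ B′ ∣) _ _ _ ⟩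
    (∣ B′ ∣ + ∣ R′ ∣) + (defect B′ + nonfull j R′) ≡⟨ cong (_+ (defect B′ + nonfull j R′)) (∣take∣+∣drop∣ (suc b) S′) ⟩
    ∣ S′ ∣ + (defect B′ + nonfull j R′)           ∎
    where
    open ≤-Reasoning
    B = take (suc b) S
    B′ = take (suc b) S′
    R = drop (suc b) S
    R′ = drop (suc b) S′

  nonfull≡0⇒∣S∣≡ : ∀ j S → nonfull j S ≡ 0 → ∣ S ∣ ≡ j * suc b
  nonfull≡0⇒∣S∣≡ zero [] _ = refl
  nonfull≡0⇒∣S∣≡ (suc j) S eq = trans (sym (∣take∣+∣drop∣ (suc b) S)) (cong₂ _+_
    (defect≡0⇒∣p∣≡n (take (suc b) S) (m+n≡0⇒m≡0 _ eq))
    (nonfull≡0⇒∣S∣≡ j (drop (suc b) S) (m+n≡0⇒n≡0 (defect (take (suc b) S)) eq)))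

  nonfull-⊤ : ∀ j → nonfull j ⊤ ≡ 0
  nonfull-⊤ zero = refl
  nonfull-⊤ (suc j) = trans (cong (nonfull (suc j)) (sym (⊤++⊤ (suc b))))
    (trans (nonfull-++ j ⊤ ⊤) (cong₂ _+_ (defect-⊤ (suc b)) (nonfull-⊤ j)))

  nonfull-⊥ : ∀ j → nonfull j ⊥ ≡ j
  nonfull-⊥ zero = refl
  nonfull-⊥ (suc j) = trans (cong (nonfull (suc j)) (sym (⊥++⊥ (suc b))))
    (trans (nonfull-++ j ⊥ ⊥) (cong suc (nonfull-⊥ j)))

  omit : ∀ j → Fin j → Subset (j * suc b)
  omit (suc j) zero = ⊥ {suc b} ++ ⊤
  omit (suc j) (suc i) = ⊤ {suc b} ++ omit j i

  nonfull-omit : ∀ j i → nonfull j (omit j i) ≡ 1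
  nonfull-omit (suc j) zero = trans (nonfull-++ j ⊥ ⊤) (cong suc (nonfull-⊤ j))
  nonfull-omit (suc j) (suc i) = trans (nonfull-++ j ⊤ (omit j i))
    (cong₂ _+_ (defect-⊤ (suc b)) (nonfull-omit j i))

  ∣omit∣ : ∀ j i → ∣ omit j i ∣ + suc b ≡ j * suc b
  ∣omit∣ (suc j) zero = begin
    ∣ ⊥ {suc b} ++ ⊤ {j * suc b} ∣ + suc b  ≡⟨ cong (_+ suc b) (∣p++q∣ (⊥ {suc b}) (⊤ {j * suc b})) ⟩
    ∣ ⊥ {b} ∣ + ∣ ⊤ {j * suc b} ∣ + suc b   ≡⟨ cong₂ (λ x y → x + y + suc b) (∣⊥∣≡0 b) (∣⊤∣≡n (j * suc b)) ⟩
    j * suc b + suc b                       ≡⟨ +-comm (j * suc b) (suc b) ⟩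
    suc b + j * suc b                       ∎
    where open ≡-Reasoning
  ∣omit∣ (suc j) (suc i) = begin
    ∣ ⊤ {suc b} ++ omit j i ∣ + suc b       ≡⟨ cong (_+ suc b) (∣p++q∣ (⊤ {suc b}) (omit j i)) ⟩
    ∣ ⊤ {suc b} ∣ + ∣ omit j i ∣ + suc b    ≡⟨ +-assoc (∣ ⊤ {suc b} ∣) _ _ ⟩
    ∣ ⊤ {suc b} ∣ + (∣ omit j i ∣ + suc b)  ≡⟨ cong₂ _+_ (∣⊤∣≡n (suc b)) (∣omit∣ j i) ⟩
    suc b + j * suc b                       ∎
    where open ≡-Reasoning

  -- The sets `omit j i` have empty intersection. By induction, applied to the sets containing the
  -- first block, the later ones meet in that block alone, which the first one avoids; `P ⊤` covers
  -- the empty intersection.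
  ∩-closed-omit⇒⊥ : ∀ j (P : Subset (j * suc b) → Set) → P ⊤
    → (∀ {S S′} → P S → P S′ → P (S ∩ S′)) → (∀ i → P (omit j i)) → P ⊥
  ∩-closed-omit⇒⊥ zero P P⊤ _ _ = P⊤
  ∩-closed-omit⇒⊥ (suc j) P P⊤ P∩ Pomit = subst P eq (P∩ (Pomit zero) P⊤++⊥)
    where
    P⊤++⊥ : P (⊤ {suc b} ++ ⊥)
    P⊤++⊥ = ∩-closed-omit⇒⊥ j (λ S → P (⊤ {suc b} ++ S)) (subst P (sym (⊤++⊤ (suc b))) P⊤)
      (λ {S} {S′} p p′ → subst P
        (trans (zipWith-++ _ (⊤ {suc b}) S ⊤ S′) (cong (_++ (S ∩ S′)) (∩-idem ⊤))) (P∩ p p′))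
      (λ i → Pomit (suc i))
    eq : (⊥ {suc b} ++ ⊤) ∩ (⊤ {suc b} ++ ⊥) ≡ ⊥ {suc j * suc b}
    eq = trans (zipWith-++ _ (⊥ {suc b}) ⊤ ⊤ ⊥)
      (trans (cong₂ _++_ (∩-zeroˡ (⊤ {suc b})) (∩-zeroʳ (⊤ {j * suc b}))) (⊥++⊥ (suc b)))

-- Rank and closure in a matroid

module _ {n} (N : Matroid n) where

  rk-submod-⊆ : ∀ P Q {U I} → U ⊆ P ∪ Q → I ⊆ P ∩ Q → rk N U + rk N I ≤ rk N P + rk N Q
  rk-submod-⊆ P Q U⊆ I⊆ = ≤-trans (+-mono-≤ (rk-mono N U⊆) (rk-mono N I⊆)) (rk-submod N P Q)

  -- Diminishing returns: submodularity for `W` and `Z ∪ K`, whose intersection contains `Z`.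
  rk-diminishing : ∀ {Z W} K → Z ⊆ W → rk N Z + rk N (W ∪ K) ≤ rk N W + rk N (Z ∪ K)
  rk-diminishing {Z} {W} K Z⊆W = ≤-trans (≤-reflexive (+-comm (rk N Z) _))
    (rk-submod-⊆ W (Z ∪ K) (∪-mono-⊆ ⊆-refl (q⊆p∪q Z K)) (∩-greatest Z⊆W (p⊆p∪q K)))

  rk-spanned : ∀ Z {W} → (∀ {e} → e ∈ W → rk N (Z ∪ ⁅ e ⁆) ≤ rk N Z) → rk N (Z ∪ W) ≤ rk N Z
  rk-spanned Z {W} spanned = ≤-trans
    (rk-mono N (∪-mono-⊆ ⊆-refl (λ e∈W → ∈⋃ (∈-filter⁺ (_∈? W) (∈-allFin _) e∈W))))
    (⋃-spanned (all-filter (_∈? W) (allFin n)))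
    where
    ∈⋃ : ∀ {e L} → e ∈ˡ L → e ∈ ⋃ (map ⁅_⁆ L)
    ∈⋃ {L = _ ∷ L} (here refl) = p⊆p∪q (⋃ (map ⁅_⁆ L)) (x∈⁅x⁆ _)
    ∈⋃ {L = e′ ∷ L} (there e∈L) = q⊆p∪q ⁅ e′ ⁆ _ (∈⋃ e∈L)
    ⋃-spanned : ∀ {L} → All (_∈ W) L → rk N (Z ∪ ⋃ (map ⁅_⁆ L)) ≤ rk N Z
    ⋃-spanned [] = ≤-reflexive (cong (rk N) (∪-identityʳ Z))
    -- `Z ∪ ⁅ e ⁆` and `Z ∪ V` both have the rank of `Z` and both contain `Z`, so submodularity
    -- bounds their union.
    ⋃-spanned {e ∷ L} (e∈W ∷ L⊆W) = +-cancelʳ-≤ (rk N Z) _ _ (≤-trans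
      (rk-submod-⊆ (Z ∪ ⁅ e ⁆) (Z ∪ V)
        (∪-least (p⊆p∪q (Z ∪ V) ∘ p⊆p∪q ⁅ e ⁆) (∪-mono-⊆ (q⊆p∪q Z ⁅ e ⁆) (q⊆p∪q Z V)))
        (∩-greatest (p⊆p∪q ⁅ e ⁆) (p⊆p∪q V)))
      (+-mono-≤ (spanned e∈W) (⋃-spanned L⊆W)))
      where V = ⋃ (map ⁅_⁆ L)

  ∈cl⁻ : ∀ Z {e} → e ∈ cl N Z → rk N (Z ∪ ⁅ e ⁆) ≤ rk N Z
  ∈cl⁻ Z {e} e∈cl with rk N (Z ∪ ⁅ e ⁆) ≟ rk N Z
  ... | yes eq = ≤-reflexive eq
  ... | no ≢ with trans (sym (cong (if_then inside else outside) (dec-false (_ ≟ _) ≢)))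
                        (trans (sym (lookup∘tabulate _ e)) ([]=⇒lookup e∈cl))
  ... | ()

  ∈cl⁺ : ∀ Z {e} → rk N (Z ∪ ⁅ e ⁆) ≤ rk N Z → e ∈ cl N Z
  ∈cl⁺ Z {e} Ze≤Z = lookup⇒[]= e _ (trans (lookup∘tabulate _ e)
    (cong (if_then inside else outside)
      (dec-true (_ ≟ _) (≤-antisym Ze≤Z (rk-mono N (p⊆p∪q ⁅ e ⁆))))))

  ⊆cl : ∀ Z → Z ⊆ cl N Z
  ⊆cl Z e∈Z = ∈cl⁺ Z (rk-mono N (∪-least ⊆-refl (λ x∈ → subst (_∈ Z) (sym (x∈⁅y⁆⇒x≡y _ x∈)) e∈Z)))

  rk-∪-cl : ∀ Z → rk N (Z ∪ cl N Z) ≤ rk N Z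
  rk-∪-cl Z = rk-spanned Z (∈cl⁻ Z)

  cl-mono : ∀ {Z W} → Z ⊆ W → cl N Z ⊆ cl N W
  cl-mono {Z} {W} Z⊆W {e} e∈clZ = ∈cl⁺ W (+-cancelˡ-≤ (rk N Z) _ _ (≤-trans
    (rk-diminishing ⁅ e ⁆ Z⊆W)
    (≤-trans (+-monoʳ-≤ (rk N W) (∈cl⁻ Z e∈clZ)) (≤-reflexive (+-comm (rk N W) _)))))

  flat-⊆ : ∀ {Z W} → IsFlat N Z → rk N (Z ∪ W) ≤ rk N Z → W ⊆ Z
  flat-⊆ {Z} {W} flat ZW≤Z e∈W = subst (_ ∈_) flat (∈cl⁺ Z (≤-trans
    (rk-mono N (∪-mono-⊆ ⊆-refl (λ x∈ → subst (_∈ W) (sym (x∈⁅y⁆⇒x≡y _ x∈)) e∈W))) ZW≤Z))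

module _ {n m} (N : Matroid (n + m)) where

  rk-++-mono : ∀ (Z Z′ : Subset n) {S S′ : Subset m} → Z ⊆ Z′ → S ⊆ S′ → rk N (Z ++ S) ≤ rk N (Z′ ++ S′)
  rk-++-mono Z Z′ Z⊆Z′ S⊆S′ = rk-mono N (++-mono-⊆ Z Z′ Z⊆Z′ S⊆S′)

  rk-++-submod : ∀ (Z Z′ : Subset n) (S S′ : Subset m) →
    rk N ((Z ∪ Z′) ++ (S ∪ S′)) + rk N ((Z ∩ Z′) ++ (S ∩ S′)) ≤ rk N (Z ++ S) + rk N (Z′ ++ S′)
  rk-++-submod Z Z′ S S′ = rk-submod-⊆ N (Z ++ S) (Z′ ++ S′)
    (⊆-reflexive (sym (zipWith-++ _ Z S Z′ S′))) (⊆-reflexive (sym (zipWith-++ _ Z S Z′ S′)))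

embed-mono : ∀ l {Z W : Subset n} → Z ⊆ W → embed l Z ⊆ embed l W
embed-mono l {Z} {W} Z⊆W = ++-mono-⊆ Z W Z⊆W (⊆-refl {x = ⊥})

-- Quotients that lower X and Y, obtained by contraction

-- The rank function q of a quotient of M in which X and Y lose rank k and X ∩ Y loses none,
-- normalised so that q Z is the quotient rank of Z ∪ (X ∩ Y).
record Lowering {n} (M : Matroid n) (X Y : Subset n) (k : ℕ) : Set where
  field
    q          : Subset n → ℕ
    q-mono     : ∀ {Z W} → Z ⊆ W → q Z ≤ q W
    q-submod   : ∀ Z W → q (Z ∪ W) + q (Z ∩ W) ≤ q Z + q W
    q-quotient : ∀ {Z W} → Z ⊆ W → rk M Z + q W ≤ rk M W + q Z
    q-lift     : ∀ Z → rk M Z ≤ q Z + k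
    q-left     : q X + k ≤ rk M X
    q-right    : q Y + k ≤ rk M Y
    q-floor    : ∀ Z → rk M (X ∩ Y) ≤ q Z

-- Contract `K` in `N` and restrict to the ground set of `M`. The offset `c` plays the role of rk K
-- minus rk (X ∩ Y), which gives the normalisation; the first bound makes the truncated subtraction
-- exact.
contraction⇒lowering : ∀ {n l} (M : Matroid n) (N : Matroid (n + l)) → IsExtension {n} {l} M N
  → ∀ X Y k c K → rk M (X ∩ Y) + c ≤ rk N K
  → (∀ Z → rk M Z + c ≤ rk N (embed l Z ∪ K) + k)
  → rk N (embed l X ∪ K) + k ≤ rk M X + c
  → rk N (embed l Y ∪ K) + k ≤ rk M Y + c
  → Lowering M X Y k
contraction⇒lowering {n} {l} M N ext X Y k c K floor lift left right = record
  { q          = λ Z → u Z ∸ c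
  ; q-mono     = λ Z⊆W → ∸-monoˡ-≤ c (rk-mono N (∪-mono-⊆ (embed-mono l Z⊆W) ⊆-refl))
  ; q-submod   = λ Z W → +-cancelʳ-≤ (c + c) _ _ (subst₂ _≤_ (shift₂ (Z ∪ W) (Z ∩ W)) (shift₂ Z W)
      (rk-submod-⊆ N (embed l Z ∪ K) (embed l W ∪ K)
        (∪-least (embed-∪ Z W) (p⊆p∪q _ ∘ q⊆p∪q (embed l Z) K))
        (∩-greatest (∪-mono-⊆ (embed-mono l (p∩q⊆p Z W)) ⊆-refl)
                    (∪-mono-⊆ (embed-mono l (p∩q⊆q Z W)) ⊆-refl))))
  ; q-quotient = λ {Z} {W} Z⊆W → +-cancelʳ-≤ c _ _ (subst₂ _≤_ (shift (rk M Z) W) (shift (rk M W) Z)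
      (subst₂ (λ r r′ → r + u W ≤ r′ + u Z) (ext Z) (ext W)
        (rk-diminishing N K (embed-mono l Z⊆W))))
  ; q-lift     = λ Z → +-cancelʳ-≤ c _ _ (≤-trans (lift Z) (≤-reflexive (shiftʳ Z)))
  ; q-left     = +-cancelʳ-≤ c _ _ (≤-trans (≤-reflexive (sym (shiftʳ X))) left)
  ; q-right    = +-cancelʳ-≤ c _ _ (≤-trans (≤-reflexive (sym (shiftʳ Y))) right)
  ; q-floor    = λ Z → +-cancelʳ-≤ c _ _ (≤-trans floor (≤-trans (rk-mono N (q⊆p∪q _ K))
      (≤-reflexive (sym (u∸c+c Z)))))
  }
  where
  u : Subset n → ℕ
  u Z = rk N (embed l Z ∪ K)
  u∸c+c : ∀ Z → u Z ∸ c + c ≡ u Z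
  u∸c+c Z = m∸n+n≡m (≤-trans (m≤n+m c _) (≤-trans floor (rk-mono N (q⊆p∪q (embed l Z) K))))
  shift : ∀ r Z → r + u Z ≡ r + (u Z ∸ c) + c
  shift r Z = sym (trans (+-assoc r _ c) (cong (r +_) (u∸c+c Z)))
  shiftʳ : ∀ Z → u Z + k ≡ (u Z ∸ c) + k + c
  shiftʳ Z = trans (+-comm (u Z) k) (trans (shift k Z) (cong (_+ c) (+-comm k _)))
  shift₂ : ∀ Z W → u Z + u W ≡ (u Z ∸ c) + (u W ∸ c) + (c + c)
  shift₂ Z W = sym (trans (+-interchange (u Z ∸ c) _ c c) (cong₂ _+_ (u∸c+c Z) (u∸c+c W)))
  embed-∪ : ∀ Z W → embed l (Z ∪ W) ⊆ (embed l Z ∪ K) ∪ (embed l W ∪ K)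
  embed-∪ Z W = ⊆-trans
    (⊆-reflexive (trans (cong ((Z ∪ W) ++_) (sym (∪-idem ⊥))) (sym (zipWith-++ _ Z ⊥ W ⊥))))
    (∪-mono-⊆ (p⊆p∪q K) (p⊆p∪q K))

-- Matroids on a disjoint union, as minima of rank bounds

module Glue {n m} (f : Subset n → Subset m → ℕ)
  (f-card : ∀ Z S → f Z S ≤ ∣ Z ∣ + ∣ S ∣)
  (f-mono : ∀ {Z Z′ S S′} → Z ⊆ Z′ → S ⊆ S′ → f Z S ≤ f Z′ S′)
  (f-submod : ∀ Z Z′ S S′ → f (Z ∪ Z′) (S ∪ S′) + f (Z ∩ Z′) (S ∩ S′) ≤ f Z S + f Z′ S′)
  where

  glue : Matroid (n + m)
  glue = record
    { rk        = λ P → f (take n P) (drop n P)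
    ; rk-card   = λ P → ≤-trans (f-card _ _) (≤-reflexive (∣take∣+∣drop∣ n P))
    ; rk-mono   = λ {P} {Q} P⊆Q →
        f-mono (proj₁ (take-drop-⊆ n {p = P} {Q} P⊆Q)) (proj₂ (take-drop-⊆ n {p = P} {Q} P⊆Q))
    ; rk-submod = λ P Q → subst₂ (λ u i → u + i ≤ f (take n P) (drop n P) + f (take n Q) (drop n Q))
        (sym (cong₂ f (take-∪ n P Q) (drop-∪ n P Q)))
        (sym (cong₂ f (take-∩ n P Q) (drop-∩ n P Q)))
        (f-submod (take n P) (take n Q) (drop n P) (drop n Q))
    }

  rk-glue : ∀ Z S → rk glue (Z ++ S) ≡ f Z S
  rk-glue Z S = cong₂ f (proj₁ (take-drop-++ n Z S)) (proj₂ (take-drop-++ n Z S))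

module _ {n} {M : Matroid n} {X Y : Subset n} {k} (L : Lowering M X Y k) where
  open Lowering L

  -- `X ∩ Y` is closed in the quotient. As `q` never falls below the floor, submodularity gives
  -- `q (F ∪ Z) ≤ q F` for F = X, Y; since `F` already loses the maximal amount `k`, its rank in `M`
  -- does not grow either, and flatness applies.
  q-≤-floor⇒⊆ : IsFlat M X → IsFlat M Y → ∀ {Z} → q Z ≤ rk M (X ∩ Y) → Z ⊆ X ∩ Y
  q-≤-floor⇒⊆ flatX flatY {Z} low =
    ∩-greatest (flat-⊆ M flatX (absorb q-left)) (flat-⊆ M flatY (absorb q-right))
    where
    absorb : ∀ {F} → q F + k ≤ rk M F → rk M (F ∪ Z) ≤ rk M F
    absorb {F} qF = ≤-trans (q-lift (F ∪ Z)) (≤-trans (+-monoˡ-≤ k (+-cancelʳ-≤ (q (F ∩ Z)) _ _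
      (≤-trans (q-submod F Z) (+-monoʳ-≤ (q F) (≤-trans low (q-floor (F ∩ Z))))))) qF)

  -- Add submodularity of `q` to the quotient inequality for `Z ∩ W ⊆ Z`, then cancel.
  q-rk-submod : ∀ Z W → q (Z ∪ W) + rk M (Z ∩ W) ≤ rk M Z + q W
  q-rk-submod Z W = +-cancelʳ-≤ (q Z + q (Z ∩ W)) _ _ (begin
    q (Z ∪ W) + rk M (Z ∩ W) + (q Z + q (Z ∩ W))      ≡⟨ left (q (Z ∪ W)) _ (q Z) _ ⟩
    (q (Z ∪ W) + q (Z ∩ W)) + (rk M (Z ∩ W) + q Z)
      ≤⟨ +-mono-≤ (q-submod Z W) (q-quotient (p∩q⊆p Z W)) ⟩
    (q Z + q W) + (rk M Z + q (Z ∩ W))                ≡⟨ right (q Z) _ (rk M Z) _ ⟩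
    rk M Z + q W + (q Z + q (Z ∩ W))                  ∎)
    where
    open ≤-Reasoning
    left : ∀ a b c d → a + b + (c + d) ≡ (a + d) + (b + c)
    left = solve-∀
    right : ∀ a b c d → (a + b) + (c + d) ≡ c + b + (a + d)
    right = solve-∀

  -- Both extensions have this shape: new elements are free over `M`, except that the rank is
  -- limited by the quotient, where `v` measures the new part, and by a constant.
  module Join {m} (v : Subset m → ℕ) (cap : ℕ) where

    join : Subset n → Subset m → ℕ
    join Z S = (rk M Z + ∣ S ∣) ⊓ ((q Z + v S) ⊓ cap)

    join≤free : ∀ Z S → join Z S ≤ rk M Z + ∣ S ∣
    join≤free Z S = m⊓n≤m _ _

    join≤lowered : ∀ Z S → join Z S ≤ q Z + v S
    join≤lowered Z S = ≤-trans (m⊓n≤n (rk M Z + ∣ S ∣) _) (m⊓n≤m _ _)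

    join≤cap : ∀ Z S → join Z S ≤ cap
    join≤cap Z S = ≤-trans (m⊓n≤n (rk M Z + ∣ S ∣) _) (m⊓n≤n (q Z + v S) _)

    join-glb : ∀ {a} Z S → a ≤ rk M Z + ∣ S ∣ → a ≤ q Z + v S → a ≤ cap → a ≤ join Z S
    join-glb Z S p p′ p″ = ⊓-glb p (⊓-glb p′ p″)

    data Attained (Z : Subset n) (S : Subset m) : Set where
      free    : join Z S ≡ rk M Z + ∣ S ∣ → Attained Z S
      lowered : join Z S ≡ q Z + v S → Attained Z S
      capped  : join Z S ≡ cap → Attained Z S

    attained : ∀ Z S → Attained Z S
    attained Z S with ⊓-sel (rk M Z + ∣ S ∣) ((q Z + v S) ⊓ cap)
    ... | inj₁ eq = free eq
    ... | inj₂ eq with ⊓-sel (q Z + v S) cap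
    ...   | inj₁ eq′ = lowered (trans eq eq′)
    ...   | inj₂ eq′ = capped (trans eq eq′)

    module Glued
      (v-mono : ∀ {S S′} → S ⊆ S′ → v S ≤ v S′)
      -- That is, adding `S` to `S′` raises `v` by at most the number of new elements.
      (v-slope : ∀ S S′ → v (S ∪ S′) + ∣ S ∩ S′ ∣ ≤ ∣ S ∣ + v S′)
      -- The left side has `join` in place of `q + v`, because `v` may fail to be submodular and the
      -- other bounds must then help.
      (v-cross : ∀ Z Z′ S S′ →
        join (Z ∪ Z′) (S ∪ S′) + join (Z ∩ Z′) (S ∩ S′) ≤ (q Z + v S) + (q Z′ + v S′))
      where

      join-mono : ∀ {Z Z′ S S′} → Z ⊆ Z′ → S ⊆ S′ → join Z S ≤ join Z′ S′
      join-mono {Z} {Z′} {S} {S′} Z⊆ S⊆ = join-glb Z′ S′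
        (≤-trans (join≤free Z S) (+-mono-≤ (rk-mono M Z⊆) (p⊆q⇒∣p∣≤∣q∣ S⊆)))
        (≤-trans (join≤lowered Z S) (+-mono-≤ (q-mono Z⊆) (v-mono S⊆)))
        (join≤cap Z S)

      -- The union takes the quotient bound and the intersection the free one, which is where the
      -- mixed inequality `q-rk-submod` enters.
      free-lowered : ∀ Z Z′ S S′ → join (Z ∪ Z′) (S ∪ S′) + join (Z ∩ Z′) (S ∩ S′)
                                   ≤ (rk M Z + ∣ S ∣) + (q Z′ + v S′)
      free-lowered Z Z′ S S′ = begin
        join (Z ∪ Z′) (S ∪ S′) + join (Z ∩ Z′) (S ∩ S′)
          ≤⟨ +-mono-≤ (join≤lowered (Z ∪ Z′) _) (join≤free (Z ∩ Z′) _) ⟩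
        (q (Z ∪ Z′) + v (S ∪ S′)) + (rk M (Z ∩ Z′) + ∣ S ∩ S′ ∣)
          ≡⟨ +-interchange (q (Z ∪ Z′)) _ _ _ ⟩
        (q (Z ∪ Z′) + rk M (Z ∩ Z′)) + (v (S ∪ S′) + ∣ S ∩ S′ ∣)
          ≤⟨ +-mono-≤ (q-rk-submod Z Z′) (v-slope S S′) ⟩
        (rk M Z + q Z′) + (∣ S ∣ + v S′)
          ≡⟨ +-interchange (rk M Z) _ _ _ ⟩
        (rk M Z + ∣ S ∣) + (q Z′ + v S′) ∎
        where open ≤-Reasoning

      free-free : ∀ Z Z′ S S′ → join (Z ∪ Z′) (S ∪ S′) + join (Z ∩ Z′) (S ∩ S′)
                                ≤ (rk M Z + ∣ S ∣) + (rk M Z′ + ∣ S′ ∣)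
      free-free Z Z′ S S′ = begin
        join (Z ∪ Z′) (S ∪ S′) + join (Z ∩ Z′) (S ∩ S′)
          ≤⟨ +-mono-≤ (join≤free (Z ∪ Z′) _) (join≤free (Z ∩ Z′) _) ⟩
        (rk M (Z ∪ Z′) + ∣ S ∪ S′ ∣) + (rk M (Z ∩ Z′) + ∣ S ∩ S′ ∣)
          ≡⟨ +-interchange (rk M (Z ∪ Z′)) _ _ _ ⟩
        (rk M (Z ∪ Z′) + rk M (Z ∩ Z′)) + (∣ S ∪ S′ ∣ + ∣ S ∩ S′ ∣)
          ≤⟨ +-mono-≤ (rk-submod M Z Z′) (≤-reflexive (∣p∪q∣+∣p∩q∣ S S′)) ⟩
        (rk M Z + rk M Z′) + (∣ S ∣ + ∣ S′ ∣)
          ≡⟨ +-interchange (rk M Z) _ _ _ ⟩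
        (rk M Z + ∣ S ∣) + (rk M Z′ + ∣ S′ ∣) ∎
        where open ≤-Reasoning

      join-submod : ∀ Z Z′ S S′ →
        join (Z ∪ Z′) (S ∪ S′) + join (Z ∩ Z′) (S ∩ S′) ≤ join Z S + join Z′ S′
      join-submod Z Z′ S S′ with attained Z S | attained Z′ S′
      ... | capped eq | _ rewrite eq =
        +-mono-≤ (join≤cap (Z ∪ Z′) _) (join-mono (p∩q⊆q Z Z′) (p∩q⊆q S S′))
      ... | _ | capped eq rewrite eq = ≤-trans
        (+-mono-≤ (join≤cap (Z ∪ Z′) _) (join-mono (p∩q⊆p Z Z′) (p∩q⊆p S S′)))
        (≤-reflexive (+-comm cap _))
      ... | free eq | free eq′ rewrite eq | eq′ = free-free Z Z′ S S′
      ... | free eq | lowered eq′ rewrite eq | eq′ = free-lowered Z Z′ S S′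
      ... | lowered eq | lowered eq′ rewrite eq | eq′ = v-cross Z Z′ S S′
      ... | lowered eq | free eq′ rewrite eq | eq′ | ∪-comm Z Z′ | ∪-comm S S′ | ∩-comm Z Z′ | ∩-comm S S′ =
        ≤-trans (free-lowered Z′ Z S′ S) (≤-reflexive (+-comm (rk M Z′ + ∣ S′ ∣) _))

      open Glue join (λ Z S → ≤-trans (join≤free Z S) (+-monoˡ-≤ ∣ S ∣ (rk-card M Z)))
        join-mono join-submod public

    join-⊥ : (∀ Z → rk M Z ≤ q Z + v ⊥) → (∀ Z → rk M Z ≤ cap) → ∀ Z → join Z ⊥ ≡ rk M Z
    join-⊥ ≤v ≤cap Z = ≤-antisym
      (≤-trans (join≤free Z ⊥) (≤-reflexive rk+0))
      (join-glb Z ⊥ (≤-reflexive (sym rk+0)) (≤v Z) (≤cap Z))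
      where
      rk+0 : rk M Z + ∣ ⊥ {m} ∣ ≡ rk M Z
      rk+0 = trans (cong (rk M Z +_) (∣⊥∣≡0 m)) (+-identityʳ _)

-- The two extensions of M

-- Truncation costs a unit only when `u` is 0 while `a` and `b` are positive: the union fills every
-- block but neither set does.
∸1-submod : ∀ u i a b → u ≤ a → u ≤ b → u + i ≤ a + b →
  (u ∸ 1) + (i ∸ 1) ≤ (a ∸ 1) + (b ∸ 1) ⊎ (u ≡ 0 × i ∸ 1 ≤ suc ((a ∸ 1) + (b ∸ 1)))
∸1-submod zero i zero b _ _ h = inj₁ (∸-monoˡ-≤ 1 h)
∸1-submod zero i (suc a) zero _ _ h = inj₁ (∸-monoˡ-≤ 1 h)
∸1-submod zero i (suc a) (suc b) _ _ h =
  inj₂ (refl , ≤-trans (∸-monoˡ-≤ 1 h) (≤-reflexive (+-suc a b)))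
∸1-submod (suc u) zero (suc a) (suc b) (s≤s u≤a) _ h =
  inj₁ (≤-trans (≤-reflexive (+-identityʳ u)) (≤-trans u≤a (m≤m+n a b)))
∸1-submod (suc u) (suc i) (suc a) (suc b) _ _ h =
  inj₁ (s≤s⁻¹ (subst₂ _≤_ (+-suc u i) (+-suc a b) (s≤s⁻¹ h)))

module Extensions {n} {M : Matroid n} {X Y : Subset n} (flatX : IsFlat M X) (flatY : IsFlat M Y)
  {k} (L : Lowering M X Y k) where
  open Lowering L
  open Blocks n

  T : Subset n
  T = X ∩ Y

  t : ℕ
  t = rk M T

  rk≤n : ∀ Z → rk M Z ≤ n
  rk≤n Z = ≤-trans (rk-card M Z) (∣p∣≤n Z)

  -- The cap n + 1 never cuts anything off: it only makes N₁ an instance of Join.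
  module J₁ = Join L {1} (λ _ → k) (n + 1)

  N₁-cross : ∀ Z Z′ S S′ →
    J₁.join (Z ∪ Z′) (S ∪ S′) + J₁.join (Z ∩ Z′) (S ∩ S′) ≤ (q Z + k) + (q Z′ + k)
  N₁-cross Z Z′ S S′ = begin
    J₁.join (Z ∪ Z′) (S ∪ S′) + J₁.join (Z ∩ Z′) (S ∩ S′)
      ≤⟨ +-mono-≤ (J₁.join≤lowered (Z ∪ Z′) (S ∪ S′)) (J₁.join≤lowered (Z ∩ Z′) (S ∩ S′)) ⟩
    (q (Z ∪ Z′) + k) + (q (Z ∩ Z′) + k)  ≡⟨ +-interchange (q (Z ∪ Z′)) _ _ _ ⟩
    (q (Z ∪ Z′) + q (Z ∩ Z′)) + (k + k)  ≤⟨ +-monoˡ-≤ (k + k) (q-submod Z Z′) ⟩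
    (q Z + q Z′) + (k + k)               ≡⟨ +-interchange (q Z) _ _ _ ⟩
    (q Z + k) + (q Z′ + k)               ∎
    where open ≤-Reasoning

  module G₁ = J₁.Glued (λ _ → ≤-refl)
    (λ S S′ → ≤-trans (≤-reflexive (+-comm k _)) (+-monoˡ-≤ k (∣p∩q∣≤∣p∣ S S′))) N₁-cross

  -- The new element lies in the closure of `Z` exactly when `q Z + k ≤ rk M Z`. This holds for X
  -- and Y, and fails for `T` when `k` is positive because `t ≤ q T`.
  N₁ : Matroid (n + 1)
  N₁ = G₁.glue

  rk-N₁ : ∀ Z S → rk N₁ (Z ++ S) ≡ J₁.join Z S
  rk-N₁ = G₁.rk-glue

  N₁-extends : IsExtension {n} {1} M N₁
  N₁-extends Z = trans (rk-N₁ Z ⊥)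
    (J₁.join-⊥ q-lift (λ Z → ≤-trans (rk≤n Z) (m≤m+n n 1)) Z)

  size : ℕ
  size = suc k * suc n

  -- Each of the k + 1 blocks is a circuit, up to the truncated subtraction, which relaxes the
  -- dependency when all the blocks are full and so makes them independent over T.
  v : Subset size → ℕ
  v S = ∣ S ∣ + (nonfull (suc k) S ∸ 1)

  module J₂ = Join L {size} v (t + size)

  v-mono : ∀ {S S′} → S ⊆ S′ → v S ≤ v S′
  v-mono {S} {S′} S⊆S′ with nonfull (suc k) S | ∣S∣+nonfull-mono (suc k) {S} {S′} S⊆S′
  ... | zero | _ = ≤-trans (≤-reflexive (+-identityʳ _)) (≤-trans (p⊆q⇒∣p∣≤∣q∣ S⊆S′) (m≤m+n _ _))
  ... | suc h | le = s≤s⁻¹ (begin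
    suc (∣ S ∣ + h)                              ≡⟨ +-suc (∣ S ∣) h ⟨
    ∣ S ∣ + suc h                                ≤⟨ le ⟩
    ∣ S′ ∣ + nonfull (suc k) S′                  ≤⟨ +-monoʳ-≤ (∣ S′ ∣) (m≤n+m∸n (nonfull (suc k) S′) 1) ⟩
    ∣ S′ ∣ + suc (nonfull (suc k) S′ ∸ 1)        ≡⟨ +-suc (∣ S′ ∣) _ ⟩
    suc (∣ S′ ∣ + (nonfull (suc k) S′ ∸ 1))      ∎)
    where open ≤-Reasoning

  v-slope : ∀ S S′ → v (S ∪ S′) + ∣ S ∩ S′ ∣ ≤ ∣ S ∣ + v S′
  v-slope S S′ = begin
    ∣ S ∪ S′ ∣ + (nonfull (suc k) (S ∪ S′) ∸ 1) + ∣ S ∩ S′ ∣  ≡⟨ swap (∣ S ∪ S′ ∣) _ _ ⟩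
    ∣ S ∪ S′ ∣ + ∣ S ∩ S′ ∣ + (nonfull (suc k) (S ∪ S′) ∸ 1)
      ≤⟨ +-mono-≤ (≤-reflexive (∣p∪q∣+∣p∩q∣ S S′))
                  (∸-monoˡ-≤ 1 (nonfull-antitone (suc k) (q⊆p∪q S S′))) ⟩
    ∣ S ∣ + ∣ S′ ∣ + (nonfull (suc k) S′ ∸ 1)                 ≡⟨ +-assoc (∣ S ∣) _ _ ⟩
    ∣ S ∣ + (∣ S′ ∣ + (nonfull (suc k) S′ ∸ 1))               ∎
    where
    open ≤-Reasoning
    swap : ∀ a b c → a + b + c ≡ a + c + b
    swap = solve-∀

  -- `v` violates submodularity by at most one, when `S ∪ S′` fills all blocks. Then either `q Z`
  -- exceeds `t` and supplies the missing unit, or `Z` lies in `T` and the free bound does better at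
  -- the intersection.
  v-cross : ∀ Z Z′ S S′ →
    J₂.join (Z ∪ Z′) (S ∪ S′) + J₂.join (Z ∩ Z′) (S ∩ S′) ≤ (q Z + v S) + (q Z′ + v S′)
  v-cross Z Z′ S S′ = case-nonfull
    (∸1-submod _ _ (nonfull (suc k) S) (nonfull (suc k) S′) (nonfull-antitone (suc k) {S} (p⊆p∪q S′))
      (nonfull-antitone (suc k) {S′} (q⊆p∪q S S′))
      (nonfull-submod (suc k) S S′))
    where
    open ≤-Reasoning
    h : Subset size → ℕ
    h R = nonfull (suc k) R ∸ 1
    Goal : Set
    Goal = J₂.join (Z ∪ Z′) (S ∪ S′) + J₂.join (Z ∩ Z′) (S ∩ S′) ≤ (q Z + v S) + (q Z′ + v S′)

    shuffle : ∀ a b c d e f → (a + (b + c)) + (d + (e + f)) ≡ (a + d) + ((b + e) + (c + f))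
    shuffle = solve-∀

    generic : h (S ∪ S′) + h (S ∩ S′) ≤ h S + h S′ → Goal
    generic h-submod = begin
      J₂.join (Z ∪ Z′) (S ∪ S′) + J₂.join (Z ∩ Z′) (S ∩ S′)
        ≤⟨ +-mono-≤ (J₂.join≤lowered (Z ∪ Z′) (S ∪ S′)) (J₂.join≤lowered (Z ∩ Z′) (S ∩ S′)) ⟩
      (q (Z ∪ Z′) + v (S ∪ S′)) + (q (Z ∩ Z′) + v (S ∩ S′))
        ≡⟨ shuffle (q (Z ∪ Z′)) (∣ S ∪ S′ ∣) _ (q (Z ∩ Z′)) (∣ S ∩ S′ ∣) _ ⟩
      (q (Z ∪ Z′) + q (Z ∩ Z′)) + ((∣ S ∪ S′ ∣ + ∣ S ∩ S′ ∣) + (h (S ∪ S′) + h (S ∩ S′)))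
        ≤⟨ +-mono-≤ (q-submod Z Z′) (+-mono-≤ (≤-reflexive (∣p∪q∣+∣p∩q∣ S S′)) h-submod) ⟩
      (q Z + q Z′) + ((∣ S ∣ + ∣ S′ ∣) + (h S + h S′))
        ≡⟨ shuffle (q Z) (∣ S ∣) _ (q Z′) (∣ S′ ∣) _ ⟨
      (q Z + v S) + (q Z′ + v S′) ∎

    covering : ∣ S ∪ S′ ∣ ≡ size → ∣ S ∣ + ∣ S′ ∣ ≡ size + ∣ S ∩ S′ ∣
    covering full = trans (sym (∣p∪q∣+∣p∩q∣ S S′)) (cong (_+ ∣ S ∩ S′ ∣) full)

    -- The only failure of submodularity of v, repaired by the cap because T is closed under q.
    crossing : ∣ S ∪ S′ ∣ ≡ size → h (S ∩ S′) ≤ suc (h S + h S′)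
      → suc t + q (Z ∩ Z′) ≤ q Z + q Z′ → Goal
    crossing full h≤ q-gap = begin
      J₂.join (Z ∪ Z′) (S ∪ S′) + J₂.join (Z ∩ Z′) (S ∩ S′)
        ≤⟨ +-mono-≤ (J₂.join≤cap (Z ∪ Z′) (S ∪ S′)) (J₂.join≤lowered (Z ∩ Z′) (S ∩ S′)) ⟩
      (t + size) + (q (Z ∩ Z′) + (∣ S ∩ S′ ∣ + h (S ∩ S′)))
        ≤⟨ +-monoʳ-≤ (t + size) (+-monoʳ-≤ (q (Z ∩ Z′)) (+-monoʳ-≤ (∣ S ∩ S′ ∣) h≤)) ⟩
      (t + size) + (q (Z ∩ Z′) + (∣ S ∩ S′ ∣ + suc (h S + h S′)))
        ≡⟨ collect t size (q (Z ∩ Z′)) (∣ S ∩ S′ ∣) (h S + h S′) ⟩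
      (suc t + q (Z ∩ Z′)) + ((size + ∣ S ∩ S′ ∣) + (h S + h S′))
        ≤⟨ +-mono-≤ q-gap (≤-reflexive (cong (_+ (h S + h S′)) (sym (covering full)))) ⟩
      (q Z + q Z′) + ((∣ S ∣ + ∣ S′ ∣) + (h S + h S′))
        ≡⟨ shuffle (q Z) (∣ S ∣) _ (q Z′) (∣ S′ ∣) _ ⟨
      (q Z + v S) + (q Z′ + v S′) ∎
      where
      collect : ∀ a b c d e → (a + b) + (c + (d + suc e)) ≡ (suc a + c) + ((b + d) + e)
      collect = solve-∀

    below : ∣ S ∪ S′ ∣ ≡ size → Z ⊆ T → Goal
    below full Z⊆T = begin
      J₂.join (Z ∪ Z′) (S ∪ S′) + J₂.join (Z ∩ Z′) (S ∩ S′)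
        ≤⟨ +-mono-≤ (J₂.join≤cap (Z ∪ Z′) (S ∪ S′)) (J₂.join≤free (Z ∩ Z′) (S ∩ S′)) ⟩
      (t + size) + (rk M (Z ∩ Z′) + ∣ S ∩ S′ ∣)
        ≤⟨ +-monoʳ-≤ (t + size) (+-monoˡ-≤ (∣ S ∩ S′ ∣) (rk-mono M (Z⊆T ∘ p∩q⊆p Z Z′))) ⟩
      (t + size) + (t + ∣ S ∩ S′ ∣)
        ≡⟨ +-interchange t size t _ ⟩
      (t + t) + (size + ∣ S ∩ S′ ∣)
        -- One `t` comes from the cap and one from the rank of `Z ∩ Z′` inside `T`; `q Z` and `q Z′`
        -- pay for one each.
        ≤⟨ +-mono-≤ (+-mono-≤ (q-floor Z) (q-floor Z′)) (≤-reflexive (sym (covering full))) ⟩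
      (q Z + q Z′) + (∣ S ∣ + ∣ S′ ∣)
        ≡⟨ +-interchange (q Z) _ _ _ ⟩
      (q Z + ∣ S ∣) + (q Z′ + ∣ S′ ∣)
        ≤⟨ +-mono-≤ (+-monoʳ-≤ (q Z) (m≤m+n (∣ S ∣) _)) (+-monoʳ-≤ (q Z′) (m≤m+n (∣ S′ ∣) _)) ⟩
      (q Z + v S) + (q Z′ + v S′) ∎

    case-nonfull : h (S ∪ S′) + h (S ∩ S′) ≤ h S + h S′
      ⊎ (nonfull (suc k) (S ∪ S′) ≡ 0 × h (S ∩ S′) ≤ suc (h S + h S′)) → Goal
    case-nonfull (inj₁ h-submod) = generic h-submod
    case-nonfull (inj₂ (none , h≤)) with nonfull≡0⇒∣S∣≡ (suc k) (S ∪ S′) none | q Z ≤? t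
    ... | full | yes low = below full (q-≤-floor⇒⊆ L flatX flatY low)
    ... | full | no high = crossing full h≤ (+-mono-≤ (≰⇒> high) (q-mono (p∩q⊆q Z Z′)))

  module G₂ = J₂.Glued v-mono v-slope v-cross

  N₂ : Matroid (n + size)
  N₂ = G₂.glue

  rk-N₂ : ∀ Z S → rk N₂ (Z ++ S) ≡ J₂.join Z S
  rk-N₂ = G₂.rk-glue

  n≤m : n ≤ size
  n≤m = ≤-trans (n≤1+n n) (m≤m+n (suc n) _)

  N₂-extends : IsExtension {n} {size} M N₂
  N₂-extends Z = trans (rk-N₂ Z ⊥) (J₂.join-⊥
    (λ Z → ≤-trans (q-lift Z) (≤-reflexive (cong (q Z +_) (sym v⊥))))
    (λ Z → ≤-trans (rk≤n Z) (≤-trans n≤m (m≤n+m size t))) Z)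
    where
    v⊥ : v ⊥ ≡ k
    v⊥ = cong₂ (λ x y → x + (y ∸ 1)) (∣⊥∣≡0 size) (nonfull-⊥ (suc k))

  -- The blocks are independent over `T`: since `t ≤ q T` the quotient does not interfere, and the
  -- cap is exactly the free value of `T` with all blocks.
  t+∣S∣≤rk-N₂ : ∀ S → t + ∣ S ∣ ≤ rk N₂ (T ++ S)
  t+∣S∣≤rk-N₂ S = subst (t + ∣ S ∣ ≤_) (sym (rk-N₂ T S)) (J₂.join-glb T S ≤-refl
    (+-mono-≤ (q-floor T) (m≤m+n (∣ S ∣) _)) (+-monoʳ-≤ t (∣p∣≤n S)))

  rk-N₂≤t+∣S∣ : ∀ S → rk N₂ (T ++ S) ≤ t + ∣ S ∣
  rk-N₂≤t+∣S∣ S = subst (_≤ t + ∣ S ∣) (sym (rk-N₂ T S)) (J₂.join≤free T S)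

  -- Consequences of an amalgam

  module Amalgam (A : Matroid (n + (1 + size))) (amalgam : IsAmalgam {n} {1} {size} N₁ N₂ A) where

    rk-A₁ : ∀ Z → rk A (Z ++ (inside ∷ ⊥)) ≡ J₁.join Z (inside ∷ [])
    rk-A₁ Z = trans (proj₁ amalgam Z (inside ∷ [])) (rk-N₁ Z _)

    rk-A₂ : ∀ Z S → rk A (Z ++ (outside ∷ S)) ≡ rk N₂ (Z ++ S)
    rk-A₂ = proj₂ amalgam

    A-extends : IsExtension {n} {1 + size} M A
    A-extends Z = trans (rk-A₂ Z ⊥) (N₂-extends Z)

    -- The case of `e` outside the closure of `T ∪ C`: contracting `K`, that is T, C and `e`, lowers
    -- X and Y by one more.
    module _ (i : Fin (suc k)) (independent : t + ∣ omit (suc k) i ∣ < rk A (T ++ (inside ∷ omit (suc k) i)))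
      where

      C : Subset size
      C = omit (suc k) i

      K : Subset (n + (1 + size))
      K = T ++ (inside ∷ C)

      embed∪K : ∀ Z → embed (1 + size) Z ∪ K ≡ (Z ∪ T) ++ (inside ∷ C)
      embed∪K Z = trans (zipWith-++ _ Z (outside ∷ ⊥) T (inside ∷ C))
        (cong (λ S → (Z ∪ T) ++ (inside ∷ S)) (∪-identityˡ C))

      v-C : v C ≡ ∣ C ∣
      v-C = trans (cong (λ h → ∣ C ∣ + (h ∸ 1)) (nonfull-omit (suc k) i)) (+-identityʳ _)

      -- Over `C` a set loses at most `k`, by the formula for `N₂`; the element `e` accounts for at
      -- most one more.
      lift : ∀ Z → rk M Z + suc ∣ C ∣ ≤ rk A (embed (1 + size) Z ∪ K) + suc k
      lift Z = begin
        rk M Z + suc ∣ C ∣                       ≡⟨ +-suc (rk M Z) _ ⟩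
        suc (rk M Z + ∣ C ∣)                     ≤⟨ s≤s (m≤n+m∸n (rk M Z + ∣ C ∣) k) ⟩
        suc (k + (rk M Z + ∣ C ∣ ∸ k))           ≤⟨ s≤s (+-monoʳ-≤ k (J₂.join-glb Z C
                                                      (m∸n≤m _ k) below-lowered below-cap)) ⟩
        suc (k + J₂.join Z C)                    ≡⟨ cong (λ r → suc (k + r)) (trans (rk-A₂ Z C) (rk-N₂ Z C)) ⟨
        suc (k + rk A (Z ++ (outside ∷ C)))      ≤⟨ s≤s (+-monoʳ-≤ k (rk-mono A Z++C⊆)) ⟩
        suc (k + rk A (embed (1 + size) Z ∪ K))     ≡⟨ +-comm (suc k) _ ⟩
        rk A (embed (1 + size) Z ∪ K) + suc k       ∎
        where
        open ≤-Reasoning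
        Z++C⊆ : Z ++ (outside ∷ C) ⊆ embed (1 + size) Z ∪ K
        Z++C⊆ = ⊆-trans (++-mono-⊆ Z (Z ∪ T) (p⊆p∪q T) (out⊆ ⊆-refl)) (⊆-reflexive (sym (embed∪K Z)))
        below-lowered : rk M Z + ∣ C ∣ ∸ k ≤ q Z + v C
        below-lowered = m≤n+o⇒m∸n≤o _ k (begin
          rk M Z + ∣ C ∣      ≤⟨ +-monoˡ-≤ (∣ C ∣) (q-lift Z) ⟩
          q Z + k + ∣ C ∣     ≡⟨ cong (_+ ∣ C ∣) (+-comm (q Z) k) ⟩
          k + q Z + ∣ C ∣     ≡⟨ +-assoc k _ _ ⟩
          k + (q Z + ∣ C ∣)   ≡⟨ cong (λ r → k + (q Z + r)) v-C ⟨
          k + (q Z + v C)     ∎)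
        below-cap : rk M Z + ∣ C ∣ ∸ k ≤ t + size
        below-cap = begin
          rk M Z + ∣ C ∣ ∸ k  ≤⟨ m∸n≤m _ k ⟩
          -- The omitted block has `suc n` elements, so it leaves room for the rank of any set of
          -- `M`.
          rk M Z + ∣ C ∣      ≤⟨ +-monoˡ-≤ (∣ C ∣) (≤-trans (rk≤n Z) (n≤1+n n)) ⟩
          suc n + ∣ C ∣       ≡⟨ +-comm (suc n) _ ⟩
          ∣ C ∣ + suc n       ≡⟨ ∣omit∣ (suc k) i ⟩
          size                   ≤⟨ m≤n+m size t ⟩
          t + size               ∎

      -- Here F is X or Y. As `e` is in the closure of `F`, submodularity for F ∪ e and F ∪ C shows
      -- that `e` adds nothing over F ∪ C, though it raises the offset by one.
      absorbed : ∀ {F} → T ⊆ F → q F + k ≤ rk M F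
        → rk A (embed (1 + size) F ∪ K) + suc k ≤ rk M F + suc ∣ C ∣
      absorbed {F} T⊆F qF = begin
        rk A (embed (1 + size) F ∪ K) + suc k   ≤⟨ +-monoˡ-≤ (suc k) spanned ⟩
        q F + ∣ C ∣ + suc k                  ≡⟨ regroup (q F) (∣ C ∣) k ⟩
        (q F + k) + suc ∣ C ∣                ≤⟨ +-monoˡ-≤ (suc ∣ C ∣) qF ⟩
        rk M F + suc ∣ C ∣                   ∎
        where
        open ≤-Reasoning
        regroup : ∀ a b c → a + b + suc c ≡ (a + c) + suc b
        regroup = solve-∀
        embed∪K⊆ : embed (1 + size) F ∪ K ⊆ (F ++ (inside ∷ ⊥)) ∪ (F ++ (outside ∷ C))
        embed∪K⊆ = ⊆-trans (⊆-reflexive (embed∪K F))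
          (⊆-trans (++-mono-⊆ (F ∪ T) (F ∪ F) (∪-mono-⊆ ⊆-refl T⊆F) (s⊆s (q⊆p∪q ⊥ C)))
            (⊆-reflexive (sym (zipWith-++ _ F (inside ∷ ⊥) F (outside ∷ C)))))
        embed⊆ : embed (1 + size) F ⊆ (F ++ (inside ∷ ⊥)) ∩ (F ++ (outside ∷ C))
        embed⊆ = ∩-greatest (++-mono-⊆ F F ⊆-refl (out⊆ ⊆-refl)) (++-mono-⊆ F F ⊆-refl (out⊆ ⊥⊆))
        spanned : rk A (embed (1 + size) F ∪ K) ≤ q F + ∣ C ∣
        spanned = +-cancelʳ-≤ (rk M F) _ _ (begin
          rk A (embed (1 + size) F ∪ K) + rk M F
            ≡⟨ cong (rk A (embed (1 + size) F ∪ K) +_) (A-extends F) ⟨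
          rk A (embed (1 + size) F ∪ K) + rk A (embed (1 + size) F)
            ≤⟨ rk-submod-⊆ A (F ++ (inside ∷ ⊥)) (F ++ (outside ∷ C)) embed∪K⊆ embed⊆ ⟩
          rk A (F ++ (inside ∷ ⊥)) + rk A (F ++ (outside ∷ C))
            ≡⟨ cong₂ _+_ (rk-A₁ F) (trans (rk-A₂ F C) (rk-N₂ F C)) ⟩
          J₁.join F (inside ∷ []) + J₂.join F C
            ≤⟨ +-mono-≤ (≤-trans (J₁.join≤lowered F (inside ∷ [])) qF) (J₂.join≤lowered F C) ⟩
          rk M F + (q F + v C)
            ≡⟨ cong (λ r → rk M F + (q F + r)) v-C ⟩
          rk M F + (q F + ∣ C ∣)
            ≡⟨ +-comm (rk M F) _ ⟩
          q F + ∣ C ∣ + rk M F ∎)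

      further : Lowering M X Y (suc k)
      further = contraction⇒lowering M A A-extends X Y (suc k) (suc ∣ C ∣) K
        (≤-trans (≤-reflexive (+-suc t _)) independent) lift
        (absorbed (p∩q⊆p X Y) q-left) (absorbed (p∩q⊆q X Y) q-right)

    not-all-spanned : 0 < k → ¬ (∀ i → rk A (T ++ (inside ∷ omit (suc k) i)) ≤ t + ∣ omit (suc k) i ∣)
    not-all-spanned 0<k spanned = 1+n≰n (begin
      suc t                       ≡⟨ +-comm 1 t ⟩
      -- Positivity of `k` enters here: it keeps `e` out of the closure of `T`.
      t + 1                       ≤⟨ J₁.join-glb T (inside ∷ []) ≤-refl (+-mono-≤ (q-floor T) 0<k)
                                       (+-monoˡ-≤ 1 (rk≤n T)) ⟩
      J₁.join T (inside ∷ [])     ≡⟨ rk-A₁ T ⟨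
      rk A (T ++ (inside ∷ ⊥))    ≤⟨ ∩-closed-omit⇒⊥ (suc k) Spanned top meet spanned ⟩
      t + ∣ ⊥ {size} ∣               ≡⟨ cong (t +_) (∣⊥∣≡0 size) ⟩
      t + 0                       ≡⟨ +-identityʳ t ⟩
      t                           ∎)
      where
      open ≤-Reasoning
      -- As `T ∪ S` has rank `t + ∣ S ∣`, this says that `e` is in its closure.
      Spanned : Subset size → Set
      Spanned S = rk A (T ++ (inside ∷ S)) ≤ t + ∣ S ∣

      t+∣_∣≤ : ∀ S → t + ∣ S ∣ ≤ rk A (T ++ (outside ∷ S))
      t+∣ S ∣≤ = subst (t + ∣ S ∣ ≤_) (sym (rk-A₂ T S)) (t+∣S∣≤rk-N₂ S)

      top : Spanned ⊤
      top = +-cancelʳ-≤ (t + ∣ C₀ ∣) _ _ (begin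
        rk A (T ++ (inside ∷ ⊤)) + (t + ∣ C₀ ∣)
          ≤⟨ +-monoʳ-≤ (rk A (T ++ (inside ∷ ⊤))) t+∣ C₀ ∣≤ ⟩
        rk A (T ++ (inside ∷ ⊤)) + rk A (T ++ (outside ∷ C₀))
          ≤⟨ rk-submod-⊆ A (T ++ (inside ∷ C₀)) (T ++ (outside ∷ ⊤))
               (⊆-trans (++-mono-⊆ T (T ∪ T) (p⊆p∪q T) (s⊆s (q⊆p∪q C₀ ⊤)))
                 (⊆-reflexive (sym (zipWith-++ _ T (inside ∷ C₀) T (outside ∷ ⊤)))))
               (∩-greatest (++-mono-⊆ T T ⊆-refl (out⊆ ⊆-refl)) (++-mono-⊆ T T ⊆-refl (out⊆ ⊆⊤))) ⟩
        rk A (T ++ (inside ∷ C₀)) + rk A (T ++ (outside ∷ ⊤))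
          ≤⟨ +-mono-≤ (spanned zero) (≤-trans (≤-reflexive (rk-A₂ T ⊤)) (rk-N₂≤t+∣S∣ ⊤)) ⟩
        (t + ∣ C₀ ∣) + (t + ∣ ⊤ {size} ∣)
          ≡⟨ +-comm (t + ∣ C₀ ∣) _ ⟩
        (t + ∣ ⊤ {size} ∣) + (t + ∣ C₀ ∣) ∎)
        where
        C₀ : Subset size
        C₀ = omit (suc k) zero

      meet : ∀ {S S′} → Spanned S → Spanned S′ → Spanned (S ∩ S′)
      -- Independence over `T` makes T ∪ S and T ∪ S′ a modular pair, so the union with `e` uses up
      -- all but `t + ∣ S ∩ S′ ∣` of the rank.
      meet {S} {S′} sp sp′ = +-cancelˡ-≤ (t + ∣ S ∪ S′ ∣) _ _ (begin
        (t + ∣ S ∪ S′ ∣) + rk A (T ++ (inside ∷ (S ∩ S′)))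
          ≤⟨ +-mono-≤ (≤-trans t+∣ S ∪ S′ ∣≤ (rk-++-mono A T (T ∪ T) (p⊆p∪q T) (out⊆ ⊆-refl)))
               (rk-++-mono A T (T ∩ T) (∩-greatest ⊆-refl ⊆-refl) ⊆-refl) ⟩
        rk A ((T ∪ T) ++ (inside ∷ (S ∪ S′))) + rk A ((T ∩ T) ++ (inside ∷ (S ∩ S′)))
          ≤⟨ rk-++-submod A T T (inside ∷ S) (inside ∷ S′) ⟩
        rk A (T ++ (inside ∷ S)) + rk A (T ++ (inside ∷ S′))
          ≤⟨ +-mono-≤ sp sp′ ⟩
        (t + ∣ S ∣) + (t + ∣ S′ ∣)
          ≡⟨ +-interchange t _ t _ ⟩
        (t + t) + (∣ S ∣ + ∣ S′ ∣)
          ≡⟨ cong (t + t +_) (∣p∪q∣+∣p∩q∣ S S′) ⟨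
        (t + t) + (∣ S ∪ S′ ∣ + ∣ S ∩ S′ ∣)
          ≡⟨ +-interchange t t _ _ ⟩
        (t + ∣ S ∪ S′ ∣) + (t + ∣ S ∩ S′ ∣) ∎)

-- Starting and iterating the lowering

lower-further : ∀ {n} {M : Matroid n} {X Y} → Sticky M → IsFlat M X → IsFlat M Y
  → ∀ {k} → Lowering M X Y (suc k) → Lowering M X Y (suc (suc k))
lower-further {n} sticky flatX flatY {k} L with sticky 1 size N₁ N₂ N₁-extends N₂-extends
  where open Extensions flatX flatY L
... | A , amalgam with any? (λ i → t + ∣ omit (2 + k) i ∣ <? rk A (T ++ (inside ∷ omit (2 + k) i)))
  where open Extensions flatX flatY L; open Blocks n
... | yes (i , independent) = Extensions.Amalgam.further flatX flatY L A amalgam i independent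
... | no none = ⊥-elim (Extensions.Amalgam.not-all-spanned flatX flatY L A amalgam (s≤s z≤n)
                  (λ i → ≮⇒≥ (λ lt → none (i , lt))))

-- Passing to closures preserves the ranks of X, Y and their union, so a smaller defect forces the
-- two closures to meet in rank greater than `rk M (X ∩ Y)`. The excess is the loss.
extension⇒lowering : ∀ {n} (M : Matroid n) X Y k (M' : Matroid (n + k)) → IsExtension {n} {k} M M'
  → δ M' (cl M' (embed k X)) (cl M' (embed k Y)) < δ M X Y
  → ∃ λ j → Lowering M X Y (suc j)
extension⇒lowering M X Y k M' ext δ'<δ
  with rk M' (cl M' (embed k X) ∩ cl M' (embed k Y)) ∸ rk M (X ∩ Y) in gap
... | zero = ⊥-elim (<⇒≱ δ'<δ (∸-mono
      (+-mono-≤ (rk≤rk-cl X) (rk≤rk-cl Y))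
      (+-mono-≤ rk-∪≤ (m∸n≡0⇒m≤n gap))))
  where
  rk≤rk-cl : ∀ Z → rk M Z ≤ rk M' (cl M' (embed k Z))
  rk≤rk-cl Z = ≤-trans (≤-reflexive (sym (ext Z))) (rk-mono M' (⊆cl M' (embed k Z)))
  rk-∪≤ : rk M' (cl M' (embed k X) ∪ cl M' (embed k Y)) ≤ rk M (X ∪ Y)
  rk-∪≤ = begin
    rk M' (cl M' (embed k X) ∪ cl M' (embed k Y))
      ≤⟨ rk-mono M' (⊆-trans (∪-least (cl-mono M' (embed-mono k (p⊆p∪q Y)))
                                      (cl-mono M' (embed-mono k (q⊆p∪q X Y))))
                             (q⊆p∪q (embed k (X ∪ Y)) _)) ⟩
    rk M' (embed k (X ∪ Y) ∪ cl M' (embed k (X ∪ Y)))  ≤⟨ rk-∪-cl M' (embed k (X ∪ Y)) ⟩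
    rk M' (embed k (X ∪ Y))                            ≡⟨ ext (X ∪ Y) ⟩
    rk M (X ∪ Y)                                       ∎
    where open ≤-Reasoning
-- Offset and loss are both the excess: adding `K` raises the rank of neither X nor Y, so the whole
-- offset is lost.
... | suc j = j , contraction⇒lowering M M' ext X Y (suc j) (suc j) K
      (≤-reflexive (trans (cong (rk M (X ∩ Y) +_) (sym gap)) (m+[n∸m]≡n (<⇒≤ (m∸n≢0⇒n<m {rk M' K} {rk M (X ∩ Y)} gap≢0)))))
      (λ Z → +-monoˡ-≤ (suc j) (≤-trans (≤-reflexive (sym (ext Z))) (rk-mono M' (p⊆p∪q K))))
      (+-monoˡ-≤ (suc j) (absorbed X (p∩q⊆p (cl M' (embed k X)) _)))
      (+-monoˡ-≤ (suc j) (absorbed Y (p∩q⊆q (cl M' (embed k X)) _)))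
  where
  K : _
  K = cl M' (embed k X) ∩ cl M' (embed k Y)
  gap≢0 : rk M' K ∸ rk M (X ∩ Y) ≢ 0
  gap≢0 eq = 1+n≢0 (trans (sym gap) eq)
  absorbed : ∀ Z → K ⊆ cl M' (embed k Z) → rk M' (embed k Z ∪ K) ≤ rk M Z
  absorbed Z K⊆ = ≤-trans (rk-mono M' (∪-mono-⊆ ⊆-refl K⊆))
    (≤-trans (rk-∪-cl M' (embed k Z)) (≤-reflexive (ext Z)))

theorem3 : ∀ {n} (M : Matroid n) (X Y : Subset n)
    → IsFlat M X → IsFlat M Y → 0 < δ M X Y
    → ∀ k (M' : Matroid (n + k)) → IsExtension M M'
    → δ M' (cl M' (embed k X)) (cl M' (embed k Y)) < δ M X Y
    → ¬ Sticky M
theorem3 M X Y flatX flatY _ k M' ext δ'<δ sticky =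
  -- Iterating `rk M X` times gives a loss `suc i` greater than the rank of `X`, against `q-left`.
  let i , rkX≤i , L = unboundedly (rk M X)
  in 1+n≰n (≤-trans (m+n≤o⇒n≤o _ (Lowering.q-left L)) rkX≤i)
  where
  unboundedly : ∀ j → ∃ λ i → j ≤ i × Lowering M X Y (suc i)
  unboundedly zero = let i , L = extension⇒lowering M X Y k M' ext δ'<δ in i , z≤n , L
  unboundedly (suc j) =
    let i , j≤i , L = unboundedly j in suc i , s≤s j≤i , lower-further sticky flatX flatY L
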